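{- Let $Y$ be a connected finite simple undirected graph with vertex set $\{1,\dots,n\}$ and let $e=\{v,w\}$ be a cycle-edge of $Y$. Let $Y'$ be obtained from $Y$ by deleting $e$ and $Y''$ by contracting $e$ (identifying $v,w$ into a single vertex). Define $\Theta\colon\mathsf{Acyc}(Y)/\!\sim_\kappa\to\big(\mathsf{Acyc}(Y')/\!\sim_\kappa\big)\cup\big(\mathsf{Acyc}(Y'')/\!\sim_\kappa\big)$ as follows: for a $\kappa$-class $[O_Y]$, let $O^\pi_Y\in[O_Y]$ with $\pi=v\pi_2\cdots\pi_n$ and $w=\pi_i$ with $i$ minimal among such choices; set $\Theta([O_Y])=[O^\pi_{Y''}]$ if there exists $O^\pi_Y\in[O_Y]$ with $\pi=vw\pi_3\cdots\pi_n$, and $\Theta([O_Y])=[O^\pi_{Y'}]$ otherwise. Then $\Theta$ is a bijection.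
   Context: A cycle-edge is an edge that is not a bridge. For a graph $Z$, $\mathsf{Acyc}(Z)$ is its set of acyclic orientations; a click converts a source into a sink by reversing its incident edges, and two acyclic orientations are $\kappa$-equivalent if one is obtained from the other by finitely many clicks; $[O]$ denotes a $\kappa$-class and $\mathsf{Acyc}(Z)/\!\sim_\kappa$ the set of classes. For a permutation (total order) $\pi$ of the vertices of $Y$, $O^\pi_Y$ is the acyclic orientation with edge $\{i,j\}$ oriented $(i,j)$ iff $i$ precedes $j$ in $\pi$; every acyclic orientation is of this form. $O^\pi_{Y'}$ and $O^\pi_{Y''}$ are the orientations of $Y'$ and $Y''$ induced by $O^\pi_Y$ under deletion and contraction of $e$ (in the contracted case, with $\pi=vw\pi_3\cdots\pi_n$, this is the orientation induced by the order $V\pi_3\cdots\pi_n$ where $V$ is the merged vertex, and is acyclic). -}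

module Defs where

open import Level using (Level; Lift)
open import Data.Empty using (⊥)
open import Data.Nat using (ℕ; zero; suc; _<_; _≤_)
open import Data.Fin using (Fin; toℕ)
open import Data.Fin.Permutation using (Permutation′; _⟨$⟩ˡ_)
open import Data.Product using (Σ; ∃; ∃-syntax; _×_; _,_; proj₁)
open import Data.Sum using (_⊎_; inj₁; inj₂)
open import Relation.Nullary using (¬_)
open import Relation.Binary.PropositionalEquality using (_≡_; _≢_)
open import Relation.Binary.Construct.Closure.ReflexiveTransitive using (Star)
open import Relation.Binary.Construct.Closure.Transitive using (TransClosure)

-- Graphs are given by an adjacency relation on a vertex type V.
-- Orientations are raw relations on V ("x → y").

Adjacency : Set → Set₁
Adjacency V = V → V → Set

record SimpleGraph (n : ℕ) : Set₁ where
  field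
    adj    : Fin n → Fin n → Set
    sym    : ∀ {x y} → adj x y → adj y x
    irrefl : ∀ {x} → ¬ adj x x
    dec    : ∀ x y → adj x y ⊎ ¬ adj x y

Connected : {V : Set} → Adjacency V → Set
Connected A = ∀ x y → Star A x y

SameEdge : ∀ {V : Set} → V → V → V → V → Set
SameEdge x y v w = (x ≡ v × y ≡ w) ⊎ (x ≡ w × y ≡ v)

delete : ∀ {V : Set} → Adjacency V → V → V → Adjacency V
delete A v w x y = A x y × ¬ SameEdge x y v w

IsBridge : ∀ {V : Set} → Adjacency V → V → V → Set
IsBridge A v w = ∃[ x ] ∃[ y ] (Star A x y × ¬ Star (delete A v w) x y)

CycleEdge : ∀ {V : Set} → Adjacency V → V → V → Set
CycleEdge A v w = A v w × ¬ IsBridge A v w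

-- Contraction Y'' = Y / e : vertex set {1..n} minus w (v is the merged
-- vertex).  merge sends w to v and fixes everything else.
ContrV : ∀ {n} → Fin n → Set
ContrV {n} w = Σ (Fin n) (λ u → u ≢ w)

Merge : ∀ {n} → Fin n → Fin n → Fin n → Fin n → Set
Merge v w x a = (x ≡ w × a ≡ v) ⊎ (x ≢ w × a ≡ x)

contract : ∀ {n} → Adjacency (Fin n) → (v w : Fin n) → Adjacency (ContrV w)
contract A v w (a , _) (b , _) =
  a ≢ b × ∃[ x ] ∃[ y ] (A x y × Merge v w x a × Merge v w y b)

record AcycOri {V : Set} (A : Adjacency V) : Set₁ where
  field
    rel     : V → V → Set
    sub     : ∀ {x y} → rel x y → A x y
    total   : ∀ {x y} → A x y → rel x y ⊎ rel y x
    asym    : ∀ {x y} → rel x y → ¬ rel y x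
    acyclic : ∀ x → ¬ TransClosure rel x x
open AcycOri public

_≐_ : ∀ {V : Set} → (V → V → Set) → (V → V → Set) → Set
O ≐ O' = ∀ x y → (O x y → O' x y) × (O' x y → O x y)

Click : ∀ {V : Set} → (V → V → Set) → (V → V → Set) → Set
Click {V} O O' = Σ V λ s → (∀ u → ¬ O u s) ×
  (∀ x y → ((((x ≡ s ⊎ y ≡ s) × O y x) ⊎ (x ≢ s × y ≢ s × O x y)) → O' x y)
         × (O' x y → (((x ≡ s ⊎ y ≡ s) × O y x) ⊎ (x ≢ s × y ≢ s × O x y))))

data Clicks {V : Set} : (V → V → Set) → (V → V → Set) → Set₁ where
  done : ∀ {O O'} → O ≐ O' → Clicks O O'
  step : ∀ {O O₁ O₂} → Click O O₁ → Clicks O₁ O₂ → Clicks O O₂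

_~κ_ : ∀ {V : Set} → (V → V → Set) → (V → V → Set) → Set₁
O ~κ O' = Clicks O O' ⊎ Clicks O' O

-- position of a vertex in π  (π ⟨$⟩ʳ i is the vertex at position i)
pos : ∀ {n} → Permutation′ n → Fin n → ℕ
pos π x = toℕ (π ⟨$⟩ˡ x)

induced : ∀ {V : Set} → Adjacency V → (V → ℕ) → V → V → Set
induced A p x y = A x y × p x < p y

-- O^π_Y, O^π_{Y'}, O^π_{Y''} (the latter using the order V π₃ ⋯ πₙ,
-- i.e. the merged vertex keeps the position of v)
Oπ : ∀ {n} → Adjacency (Fin n) → Permutation′ n → Fin n → Fin n → Set
Oπ A π = induced A (pos π)

Oπ' : ∀ {n} → Adjacency (Fin n) → (v w : Fin n) → Permutation′ n → Fin n → Fin n → Set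
Oπ' A v w π = induced (delete A v w) (pos π)

Oπ'' : ∀ {n} → Adjacency (Fin n) → (v w : Fin n) → Permutation′ n → ContrV w → ContrV w → Set
Oπ'' A v w π = induced (contract A v w) (λ a → pos π (proj₁ a))

Codom : ∀ {n} → Adjacency (Fin n) → (v w : Fin n) → Set₁
Codom A v w = AcycOri (delete A v w) ⊎ AcycOri (contract A v w)

_≈Θ_ : ∀ {n} {A : Adjacency (Fin n)} {v w : Fin n} → Codom A v w → Codom A v w → Set₁
inj₁ P ≈Θ inj₁ Q = rel P ~κ rel Q
inj₁ P ≈Θ inj₂ Q = Lift _ ⊥
inj₂ P ≈Θ inj₁ Q = Lift _ ⊥
inj₂ P ≈Θ inj₂ Q = rel P ~κ rel Q

HasVW : ∀ {n} → (A : Adjacency (Fin n)) → (v w : Fin n) → AcycOri A → Set₁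
HasVW {n} A v w O = Σ (Permutation′ n) λ π →
  pos π v ≡ 0 × pos π w ≡ 1 × (Oπ A π ~κ rel O)

Θ : ∀ {n} → (A : Adjacency (Fin n)) → (v w : Fin n) → AcycOri A → Codom A v w → Set₁
Θ {n} A v w O (inj₂ P) = Σ (Permutation′ n) λ π →
  pos π v ≡ 0 × pos π w ≡ 1 × (Oπ A π ~κ rel O) × (Oπ'' A v w π ~κ rel P)
Θ {n} A v w O (inj₁ P) = (¬ HasVW A v w O) × Σ (Permutation′ n) λ π →
  pos π v ≡ 0 × (Oπ A π ~κ rel O)
  × (∀ (σ : Permutation′ n) → pos σ v ≡ 0 → Oπ A σ ~κ rel O → pos π w ≤ pos σ w)
  × (Oπ' A v w π ~κ rel P)

IsBijectionΘ : ∀ {n} → (A : Adjacency (Fin n)) → (v w : Fin n) → Set₁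
IsBijectionΘ A v w =
    (∀ (O : AcycOri A) → Σ (Codom A v w) (Θ A v w O))
  × (∀ (O O' : AcycOri A) T T' → rel O ~κ rel O' → Θ A v w O T → Θ A v w O' T' → T ≈Θ T')
  × (∀ (O O' : AcycOri A) T T' → Θ A v w O T → Θ A v w O' T' → T ≈Θ T' → rel O ~κ rel O')
  × (∀ (T : Codom A v w) → Σ (AcycOri A) λ O → Θ A v w O T)

{-# OPTIONS --safe #-}

-- Clicks are replaced by potentials.  If c x is the number of clicks at x in a click sequence
-- from O to O′, then every arrow x → y of O satisfies either c x = c y, and it is an arrow of O′,
-- or c x = 1 + c y, and it is reversed in O′.  Conversely every such c between
-- acyclic orientations comes from a click sequence, so κ-equivalence is the existence of a potential,
-- which is visibly symmetric and transitive.
--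
-- If v → w in both O and O′ then c v = c w, so c is also a potential for the deletion and, when v
-- and w come first, for the contraction; this gives well-definedness of Θ.  For injectivity a
-- potential c on Y″ lifts to Y, and a potential c on Y′ lifts as soon as c v = c w.  To get the
-- latter, pass to orientations with v as the only source: if no member of the class starts
-- with v w, then w has an in-neighbour besides v, so w is still a descendant of v in Y′ on both
-- sides, and c decreases along arrows of O and increases along arrows of O′.
--
-- The same orientation with unique source v decides which case of Θ applies, and the ancestors
-- of w in it precede w in every order of the class that starts with v; listing them first
-- therefore attains the minimal position of w.

module Submission where

open import Defs
open import Data.Empty using (⊥; ⊥-elim)
open import Data.Nat using (ℕ; zero; suc; _+_; _*_; _∸_; _<_; _≤_; z≤n; s≤s; s≤s⁻¹; _<?_)
import Data.Nat as ℕ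
open import Data.Nat.Properties hiding (_≟_)
open import Data.Nat.Induction using (<-rec)
open import Data.Fin using (Fin; zero; suc; toℕ; fromℕ<)
import Data.Fin.Properties as Fin
open import Data.Fin.Permutation using (Permutation′; permutation; _⟨$⟩ˡ_; _⟨$⟩ʳ_; inverseˡ; inverseʳ)
open import Data.Product using (Σ; ∃; ∃-syntax; _×_; _,_; proj₁; proj₂)
open import Data.Sum using (_⊎_; inj₁; inj₂; [_,_]′; swap)
import Data.Sum as Sum
open import Function using (_∘_; id; const; case_of_)
open import Function.Definitions using (Injective)
open import Relation.Nullary using (¬_; Dec; yes; no; contradiction; ¬?; _×-dec_; _⊎-dec_)
open import Relation.Nullary.Decidable using (map′; decidable-stable)
open import Relation.Binary.Definitions using (tri<; tri≈; tri>; DecidableEquality)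
open import Relation.Binary.PropositionalEquality
open import Relation.Binary.Construct.Closure.ReflexiveTransitive using (Star; ε; _◅_; _◅◅_)
open import Relation.Binary.Construct.Closure.Transitive using (TransClosure; [_]; _∷_)

-- Finite sums and indicator functions.

∑ : ∀ {m} → (Fin m → ℕ) → ℕ
∑ {zero}  f = 0
∑ {suc m} f = f zero + ∑ (f ∘ suc)

term≤∑ : ∀ {m} (f : Fin m → ℕ) i → f i ≤ ∑ f
term≤∑ f zero    = m≤m+n _ _
term≤∑ f (suc i) = ≤-trans (term≤∑ (f ∘ suc) i) (m≤n+m _ _)

∑-mono-≤ : ∀ {m} {f g : Fin m → ℕ} → (∀ i → f i ≤ g i) → ∑ f ≤ ∑ g
∑-mono-≤ {zero}  f≤g = z≤n
∑-mono-≤ {suc m} f≤g = +-mono-≤ (f≤g zero) (∑-mono-≤ (f≤g ∘ suc))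

∑-mono-< : ∀ {m} {f g : Fin m → ℕ} → (∀ i → f i ≤ g i) → ∀ i → f i < g i → ∑ f < ∑ g
∑-mono-< f≤g zero    fi<gi = +-mono-<-≤ fi<gi (∑-mono-≤ (f≤g ∘ suc))
∑-mono-< f≤g (suc i) fi<gi = +-mono-≤-< (f≤g zero) (∑-mono-< (f≤g ∘ suc) i fi<gi)

∑-const-1 : ∀ m → ∑ {m} (const 1) ≡ m
∑-const-1 zero    = refl
∑-const-1 (suc m) = cong suc (∑-const-1 m)

indicator : {P : Set} → Dec P → ℕ
indicator (yes _) = 1
indicator (no _)  = 0

indicator-mono : {P Q : Set} (P? : Dec P) (Q? : Dec Q) → (P → Q) → indicator P? ≤ indicator Q?
indicator-mono (no _)  _       _   = z≤n
indicator-mono (yes _) (yes _) _   = s≤s z≤n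
indicator-mono (yes p) (no ¬q) P⇒Q = contradiction (P⇒Q p) ¬q

indicator-yes : {P : Set} (P? : Dec P) → P → indicator P? ≡ 1
indicator-yes (yes _) _ = refl
indicator-yes (no ¬p) p = contradiction p ¬p

indicator-no : {P : Set} (P? : Dec P) → ¬ P → indicator P? ≡ 0
indicator-no (yes p) ¬p = contradiction p ¬p
indicator-no (no _)  _  = refl

-- Finite types: minimisation, saturation, lexicographic ranks and reachability.

record Finite (V : Set) : Set where
  field
    size         : ℕ
    lookup       : Fin size → V
    index        : V → Fin size
    lookup-index : ∀ x → lookup (index x) ≡ x

module FiniteSet {V : Set} (finite : Finite V) where
  open Finite finite

  code : V → ℕ
  code = toℕ ∘ index

  code-injective : Injective _≡_ _≡_ code
  code-injective {x} {y} eq =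
    trans (sym (lookup-index x)) (trans (cong lookup (Fin.toℕ-injective eq)) (lookup-index y))

  infix 4 _≟_
  _≟_ : DecidableEquality V
  x ≟ y = map′ code-injective (cong code) (code x ℕ.≟ code y)

  any? : {P : V → Set} → (∀ x → Dec (P x)) → Dec (∃ P)
  any? {P} P? = map′ (λ (i , p) → lookup i , p)
                     (λ (x , p) → index x , subst P (sym (lookup-index x)) p)
                     (Fin.any? (P? ∘ lookup))

  sum : (V → ℕ) → ℕ
  sum f = ∑ (f ∘ lookup)

  ≤sum : ∀ f x → f x ≤ sum f
  ≤sum f x = subst (λ y → f y ≤ sum f) (lookup-index x) (term≤∑ (f ∘ lookup) (index x))

  sum-mono-≤ : ∀ {f g} → (∀ x → f x ≤ g x) → sum f ≤ sum g
  sum-mono-≤ f≤g = ∑-mono-≤ (f≤g ∘ lookup)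

  sum-mono-< : ∀ {f g} → (∀ x → f x ≤ g x) → ∀ x → f x < g x → sum f < sum g
  sum-mono-< {f} {g} f≤g x fx<gx = ∑-mono-< (f≤g ∘ lookup) (index x)
    (subst (λ y → f y < g y) (sym (lookup-index x)) fx<gx)

  argmin : {P : V → Set} → (∀ x → Dec (P x)) → (r : V → ℕ) → ∃ P →
           ∃[ x ] (P x × ∀ y → P y → r x ≤ r y)
  argmin {P} P? r (x , px) = <-rec Q descend (r x) x refl px
    where
    Q : ℕ → Set
    Q k = ∀ x → r x ≡ k → P x → ∃[ x ] (P x × ∀ y → P y → r x ≤ r y)
    descend : ∀ k → (∀ {j} → j < k → Q j) → Q k
    descend k rec x refl px with any? (λ y → P? y ×-dec (r y <? r x))
    ... | yes (y , py , ry<rx) = rec ry<rx y refl py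
    ... | no ∄y = x , px , λ y py → ≮⇒≥ (λ ry<rx → ∄y (y , py , ry<rx))

  bump : V → (V → ℕ) → V → ℕ
  bump s f x = indicator (x ≟ s) + f x

  bump-at : ∀ s f → bump s f s ≡ suc (f s)
  bump-at s f = cong (_+ f s) (indicator-yes (s ≟ s) refl)

  bump-off : ∀ {s x} f → x ≢ s → bump s f x ≡ f x
  bump-off {s} {x} f x≢s = cong (_+ f x) (indicator-no (x ≟ s) x≢s)

  -- Each bump raises `sum f`, which the bound keeps at most `sum B`, so `suc (sum B)` is enough
  -- fuel. It serves both for reachability and for clicking the sources other than `v`.
  saturate : (B : V → ℕ) (P D : (V → ℕ) → Set) →
             (∀ {f} → P f → ∀ x → f x ≤ B x) →
             (∀ f → P f → D f ⊎ ∃[ s ] P (bump s f)) →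
             ∀ f → P f → ∃[ g ] (P g × D g)
  saturate B P D bound next f pf = go (suc (sum B)) f pf (m≤n+m _ _)
    where
    go : ∀ k f → P f → sum B < sum f + k → ∃[ g ] (P g × D g)
    go zero f pf gap = contradiction
      (subst (sum B <_) (+-identityʳ _) gap) (≤⇒≯ (sum-mono-≤ (bound pf)))
    go (suc k) f pf gap with next f pf
    ... | inj₁ df       = f , pf , df
    ... | inj₂ (s , pg) = go k (bump s f) pg (<-≤-trans gap
      (≤-trans (≤-reflexive (+-suc _ k)) (+-monoˡ-≤ k
        (sum-mono-< {f} {bump s f} (λ x → m≤n+m (f x) _) s (≤-reflexive (sym (bump-at s f)))))))

  -- The order by `c` first and `r` second, coded as one number: the factor exceeds every value of
  -- `r`.
  lex : (V → ℕ) → (V → ℕ) → V → ℕ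
  lex c r x = c x * suc (sum r) + r x

  module _ (c r : V → ℕ) where

    lex-<₁ : ∀ {x y} → c x < c y → lex c r x < lex c r y
    lex-<₁ {x} {y} cx<cy = <-≤-trans
      (+-monoʳ-< (c x * suc (sum r)) (s≤s (≤sum r x)))
      (≤-trans (≤-reflexive (+-comm _ (suc (sum r))))
      (≤-trans (*-monoˡ-≤ (suc (sum r)) cx<cy) (m≤m+n _ _)))

    lex-<₂ : ∀ {x y} → c x ≡ c y → r x < r y → lex c r x < lex c r y
    lex-<₂ {x} {y} cx≡cy rx<ry rewrite cx≡cy = +-monoʳ-< (c y * suc (sum r)) rx<ry

    lex-< : ∀ {x y} → c x ≤ c y → r x < r y → lex c r x < lex c r y
    lex-< cx≤cy rx<ry with m≤n⇒m<n∨m≡n cx≤cy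
    ... | inj₁ cx<cy = lex-<₁ cx<cy
    ... | inj₂ cx≡cy = lex-<₂ cx≡cy rx<ry

    lex-injective : Injective _≡_ _≡_ r → Injective _≡_ _≡_ (lex c r)
    lex-injective r-inj {x} {y} eq with <-cmp (c x) (c y)
    ... | tri< lt _ _ = contradiction eq (<⇒≢ (lex-<₁ lt))
    ... | tri> _ _ gt = contradiction (sym eq) (<⇒≢ (lex-<₁ gt))
    ... | tri≈ _ ce _ = r-inj (+-cancelˡ-≡ (c y * suc (sum r)) _ _
                          (trans (cong (λ k → k * suc (sum r) + r x) (sym ce)) eq))

  abstract
    -- Vertices known to be reachable from `x` carry the value 1, all others 0. Saturation ends with
    -- a set closed under `R`, so a vertex of value 0 is unreachable.
    Star? : {R : V → V → Set} → (∀ x y → Dec (R x y)) → ∀ x y → Dec (Star R x y)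
    Star? {R} R? x y = decide (saturate (const 1) P D bound next (bump x (const 0)) start)
      where
      P D : (V → ℕ) → Set
      P f = f x ≡ 1 × (∀ y → f y ≡ 0 ⊎ (f y ≡ 1 × Star R x y))
      D f = ∀ y z → f y ≡ 1 → R y z → f z ≡ 1

      bound : ∀ {f} → P f → ∀ y → f y ≤ 1
      bound (_ , p) y with p y
      ... | inj₁ eq       = ≤-trans (≤-reflexive eq) z≤n
      ... | inj₂ (eq , _) = ≤-reflexive eq

      start : P (bump x (const 0))
      start = bump-at x _ , λ y → case y ≟ x of λ where
        (yes refl) → inj₂ (bump-at x _ , ε)
        (no y≢x)   → inj₁ (bump-off _ y≢x)

      next : ∀ f → P f → D f ⊎ ∃[ s ] P (bump s f)
      next f (fx , p) with any? (λ z → any? (λ y → (f y ℕ.≟ 1) ×-dec R? y z) ×-dec ¬? (f z ℕ.≟ 1))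
      ... | no ∄z = inj₁ λ y z fy yRz → decidable-stable (f z ℕ.≟ 1) (λ fz → ∄z (z , (y , fy , yRz) , fz))
      ... | yes (z , (y , fy , yRz) , fz≢1) = inj₂ (z , trans (bump-off f (λ { refl → fz≢1 fx })) fx , p′)
        where
        x⇝y : Star R x y
        x⇝y with p y
        ... | inj₁ eq = contradiction (trans (sym fy) eq) λ ()
        ... | inj₂ (_ , path) = path
        fz : f z ≡ 0
        fz = [ id , (λ (eq , _) → contradiction eq fz≢1) ]′ (p z)
        p′ : ∀ u → bump z f u ≡ 0 ⊎ (bump z f u ≡ 1 × Star R x u)
        p′ u with u ≟ z
        ... | yes refl = inj₂ (cong suc fz , x⇝y ◅◅ (yRz ◅ ε))
        ... | no  u≢z  = p u

      decide : ∃[ g ] (P g × D g) → Dec (Star R x y)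
      decide (g , (gx , p) , closed) with p y
      ... | inj₂ (_ , path) = yes path
      ... | inj₁ gy = no λ path → contradiction (trans (sym gy) (reached gx path)) λ ()
        where
        reached : ∀ {u y} → g u ≡ 1 → Star R u y → g y ≡ 1
        reached gu ε = gu
        reached gu (r ◅ path) = reached (closed _ _ gu r) path

finFinite : ∀ n → Finite (Fin n)
finFinite n = record { size = n ; lookup = id ; index = id ; lookup-index = λ _ → refl }

-- Permutations from injective rank functions.

injective⇒permutation : ∀ {n} (f : Fin n → Fin n) → Injective _≡_ _≡_ f →
                        ∃[ π ] (∀ x → π ⟨$⟩ˡ x ≡ f x)
injective⇒permutation {n} f f-inj = permutation (proj₁ ∘ surj) f
    (λ x → f-inj (proj₂ (surj (f x)))) (λ y → proj₂ (surj y)) , λ _ → refl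
  where
  surj : ∀ y → ∃[ x ] f x ≡ y
  surj y with Fin.any? (λ x → f x Fin.≟ y)
  ... | yes hit = hit
  -- Punching out the missed value would leave an injection into a smaller finite set.
  ... | no miss = ⊥-elim (omit n f f-inj y miss)
    where
    omit : ∀ m (g : Fin m → Fin m) → Injective _≡_ _≡_ g → ∀ y → ¬ (∃[ x ] g x ≡ y) → ⊥
    omit (suc m) g g-inj y miss = Fin.<⇒notInjective ≤-refl
      (λ {x} {x′} eq → g-inj (Fin.punchOut-injective (avoid x) (avoid x′) eq))
      where
      avoid : ∀ x → y ≢ g x
      avoid x y≡gx = miss (x , sym y≡gx)

abstract
  -- The position of x is the number of y with r y < r x.
  sorting : ∀ {n} (r : Fin n → ℕ) → Injective _≡_ _≡_ r →
            ∃[ π ] (∀ {x y} → r x < r y → pos π x < pos π y)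
  sorting {n} r r-inj = proj₁ π,pos , λ {x} {y} rx<ry →
      subst₂ _<_ (sym (pos≡ x)) (sym (pos≡ y)) (below-mono rx<ry)
    where
    below : Fin n → ℕ
    below x = ∑ (λ y → indicator (r y <? r x))

    below<n : ∀ x → below x < n
    -- The count is compared with the constant 1, which sums to `n`; it is strictly smaller because
    -- `x` does not count itself.
    below<n x = subst (below x <_) (∑-const-1 n)
      (∑-mono-< (λ y → indicator-mono (r y <? r x) (yes z≤n) (const (z≤n {0}))) x
        (s≤s (≤-reflexive (indicator-no (r x <? r x) (<-irrefl refl)))))

    below-mono : ∀ {x y} → r x < r y → below x < below y
    below-mono {x} {y} rx<ry = ∑-mono-<
      (λ z → indicator-mono (r z <? r x) (r z <? r y) (λ rz<rx → <-trans rz<rx rx<ry)) x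
      (subst₂ _<_ (sym (indicator-no (r x <? r x) (<-irrefl refl)))
                  (sym (indicator-yes (r x <? r y) rx<ry)) (s≤s z≤n))

    place : Fin n → Fin n
    place x = fromℕ< (below<n x)

    place-injective : Injective _≡_ _≡_ place
    place-injective {x} {y} eq with <-cmp (r x) (r y)
    ... | tri≈ _ rx≡ry _ = r-inj rx≡ry
    ... | tri< lt _ _ = contradiction (Fin.fromℕ<-injective _ _ (below<n x) (below<n y) eq) (<⇒≢ (below-mono lt))
    ... | tri> _ _ gt = contradiction (sym (Fin.fromℕ<-injective _ _ (below<n x) (below<n y) eq)) (<⇒≢ (below-mono gt))

    π,pos : ∃[ π ] (∀ x → π ⟨$⟩ˡ x ≡ place x)
    π,pos = injective⇒permutation place place-injective

    pos≡ : ∀ x → pos (proj₁ π,pos) x ≡ below x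
    pos≡ x = trans (cong toℕ (proj₂ π,pos x)) (Fin.toℕ-fromℕ< (below<n x))

pos-injective : ∀ {n} (π : Permutation′ n) → Injective _≡_ _≡_ (pos π)
pos-injective π eq = trans (sym (inverseʳ π)) (trans (cong (π ⟨$⟩ʳ_) (Fin.toℕ-injective eq)) (inverseʳ π))

vertexAt : ∀ {n} (π : Permutation′ n) {k} x → k < pos π x → ∃[ y ] pos π y ≡ k
vertexAt π x k<x = π ⟨$⟩ʳ i , trans (cong toℕ (inverseˡ π)) (Fin.toℕ-fromℕ< k<n)
  where
  k<n = <-trans k<x (Fin.toℕ<n (π ⟨$⟩ˡ x))
  i = fromℕ< k<n

pos≡0 : ∀ {n} (π : Permutation′ n) {v} → (∀ x → ¬ pos π x < pos π v) → pos π v ≡ 0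
pos≡0 π {v} first with pos π v in eq
... | zero  = refl
... | suc _ with vertexAt π v (subst (0 <_) (sym eq) (s≤s z≤n))
...   | x , x≡0 = contradiction (subst (_< _) (sym x≡0) (s≤s z≤n)) (first x)

pos≡1 : ∀ {n} (π : Permutation′ n) {v w} → v ≢ w → pos π v ≡ 0 →
        (∀ x → pos π x < pos π w → x ≡ v) → pos π w ≡ 1
pos≡1 π {v} {w} v≢w v≡0 second with pos π w in eq
... | 0 = contradiction (pos-injective π (trans v≡0 (sym eq))) v≢w
... | 1 = refl
... | suc (suc _) with vertexAt π w (subst (1 <_) (sym eq) (s≤s (s≤s z≤n)))
...   | x , x≡1 with refl ← second x (subst (_< _) (sym x≡1) (s≤s (s≤s z≤n))) =
  contradiction (trans (sym v≡0) x≡1) λ ()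

-- Orientations and the potentials between them.

record IsOrientation {V : Set} (A : Adjacency V) (O : V → V → Set) : Set where
  field
    ⊆adj    : ∀ {x y} → O x y → A x y
    orients : ∀ {x y} → A x y → O x y ⊎ O y x
    asymm   : ∀ {x y} → O x y → ¬ O y x
open IsOrientation

IsPotential : {V : Set} → (V → ℕ) → (O O′ : V → V → Set) → Set
IsPotential c O O′ = ∀ {x y} → O x y → (c x ≡ c y × O′ x y) ⊎ (c x ≡ suc (c y) × O′ y x)

Potential : {V : Set} → (O O′ : V → V → Set) → Set
Potential {V} O O′ = Σ (V → ℕ) λ c → IsPotential c O O′

module _ {V : Set} {O O′ : V → V → Set} where

  ⊆⇒potential : (∀ {x y} → O x y → O′ x y) → Potential O O′
  ⊆⇒potential O⊆O′ = const 0 , λ xy → inj₁ (refl , O⊆O′ xy)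

  -- Click counts add. An edge reversed by both potentials regains its direction, and its two unit
  -- differences, being opposite, cancel.
  potential-trans : ∀ {O″} → Potential O O′ → Potential O′ O″ → Potential O O″
  potential-trans {O″} (c , φ) (d , ψ) = (λ x → c x + d x) , χ
    where
    χ : IsPotential (λ x → c x + d x) O O″
    χ {x} {y} xy with φ xy
    ... | inj₁ (eq , xy′) with ψ xy′
    ...   | inj₁ (eq′ , xy″) = inj₁ (cong₂ _+_ eq eq′ , xy″)
    ...   | inj₂ (eq′ , yx″) = inj₂ (trans (cong₂ _+_ eq eq′) (+-suc _ _) , yx″)
    χ {x} {y} xy | inj₂ (eq , yx′) with ψ yx′
    ...   | inj₁ (eq′ , yx″) = inj₂ (cong₂ _+_ eq (sym eq′) , yx″)
    ...   | inj₂ (eq′ , xy″) = inj₁ (trans (cong (_+ d x) eq)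
                                 (trans (sym (+-suc _ _)) (cong (c y +_) (sym eq′))) , xy″)

  module _ {A : Adjacency V} (o : IsOrientation A O) (o′ : IsOrientation A O′) where

    potential-back : ∀ {c} → IsPotential c O O′ →
      ∀ {x y} → O′ x y → (c x ≡ c y × O x y) ⊎ (c y ≡ suc (c x) × O y x)
    potential-back φ {x} {y} xy′ with orients o (⊆adj o′ xy′)
    ... | inj₁ xy with φ xy
    ...   | inj₁ (eq , _)  = inj₁ (eq , xy)
    ...   | inj₂ (_ , yx′) = contradiction yx′ (asymm o′ xy′)
    potential-back φ {x} {y} xy′ | inj₂ yx with φ yx
    ...   | inj₁ (_ , yx′) = contradiction yx′ (asymm o′ xy′)
    ...   | inj₂ (eq , _)  = inj₂ (eq , yx)

    potential-≤ : ∀ {c} → IsPotential c O O′ → ∀ {x y} → O x y → c y ≤ c x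
    potential-≤ φ xy with φ xy
    ... | inj₁ (eq , _) = ≤-reflexive (sym eq)
    ... | inj₂ (eq , _) = ≤-trans (n≤1+n _) (≤-reflexive (sym eq))

    potential-≤′ : ∀ {c} → IsPotential c O O′ → ∀ {x y} → O′ x y → c x ≤ c y
    potential-≤′ φ xy′ with potential-back φ xy′
    ... | inj₁ (eq , _) = ≤-reflexive eq
    ... | inj₂ (eq , _) = ≤-trans (n≤1+n _) (≤-reflexive (sym eq))

    potential-≡ : ∀ {c} → IsPotential c O O′ → ∀ {x y} → O x y → O′ x y → c x ≡ c y
    potential-≡ φ xy xy′ = ≤-antisym (potential-≤′ φ xy′) (potential-≤ φ xy)

    -- Negating `c` undoes its differences; subtracting from the upper bound `sum c` keeps the
    -- values natural.
    potential-sym : Finite V → Potential O O′ → Potential O′ O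
    potential-sym finite (c , φ) = (λ x → sum c ∸ c x) , ψ
      where
      open FiniteSet finite
      ψ : IsPotential (λ x → sum c ∸ c x) O′ O
      ψ {x} {y} xy′ with potential-back φ xy′
      ... | inj₁ (eq , xy) = inj₁ (cong (sum c ∸_) eq , xy)
      ... | inj₂ (eq , yx) = inj₂ (trans (+-∸-assoc 1 cx<) (cong suc (cong (sum c ∸_) (sym eq))) , yx)
        where
        -- Strictness makes the truncated subtraction exact where the difference is one.
        cx< : c x < sum c
        cx< = ≤-trans (≤-reflexive (sym eq)) (≤sum c y)

induced-orientation : {V : Set} {A : Adjacency V} → (∀ {x y} → A x y → A y x) → (∀ {x} → ¬ A x x) →
  ∀ {p : V → ℕ} → Injective _≡_ _≡_ p → IsOrientation A (induced A p)
induced-orientation {A = A} A-sym A-irrefl {p} p-inj = record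
  { ⊆adj    = proj₁
  ; orients = λ {x} {y} xy → case <-cmp (p x) (p y) of λ where
      (tri< lt _ _) → inj₁ (xy , lt)
      (tri≈ _ eq _) → contradiction (subst (A x) (sym (p-inj eq)) xy) A-irrefl
      (tri> _ _ gt) → inj₂ (A-sym xy , gt)
  ; asymm   = λ (_ , lt) (_ , gt) → <-asym lt gt
  }

-- κ-equivalence as the existence of a potential.

κ-refl : ∀ {V : Set} {O : V → V → Set} → O ~κ O
κ-refl = inj₁ (done (λ _ _ → id , id))

κ-sym : ∀ {V : Set} {O O′ : V → V → Set} → O ~κ O′ → O′ ~κ O
κ-sym = swap

module Orientations {V : Set} (finite : Finite V) (A : Adjacency V)
  (A-sym : ∀ {x y} → A x y → A y x) (A-irrefl : ∀ {x} → ¬ A x x) (A? : ∀ x y → Dec (A x y)) where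
  open FiniteSet finite

  rel-orientation : (O : AcycOri A) → IsOrientation A (rel O)
  rel-orientation O = record { ⊆adj = sub O ; orients = total O ; asymm = asym O }

  module _ {p : V → ℕ} (p-inj : Injective _≡_ _≡_ p) where

    ranked : IsOrientation A (induced A p)
    ranked = induced-orientation A-sym A-irrefl p-inj

    rankedOri : AcycOri A
    rankedOri = record
      { rel = induced A p ; sub = ⊆adj ranked ; total = orients ranked ; asym = asymm ranked
      ; acyclic = λ x cycle → <-irrefl refl (increasing cycle) }
      where
      increasing : ∀ {x y} → TransClosure (induced A p) x y → p x < p y
      increasing [ _ , lt ]       = lt
      increasing ((_ , lt) ∷ path) = <-trans lt (increasing path)

  clicked : V → (V → V → Set) → V → V → Set
  clicked s O x y = ((x ≡ s ⊎ y ≡ s) × O y x) ⊎ (x ≢ s × y ≢ s × O x y)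

  click-orientation : ∀ {O O₁} → IsOrientation A O → Click O O₁ → IsOrientation A O₁
  click-orientation {O} {O₁} o (s , _ , iff) = record
    { ⊆adj    = λ xy → case proj₂ (iff _ _) xy of λ where
        (inj₁ (_ , yx))     → A-sym (⊆adj o yx)
        (inj₂ (_ , _ , xy)) → ⊆adj o xy
    ; orients = λ xy → [ (λ xy → reorient xy) , (λ yx → swap (reorient yx)) ]′ (orients o xy)
    ; asymm   = λ {x} {y} xy yx → case (proj₂ (iff _ _) xy , proj₂ (iff _ _) yx) of λ where
        (inj₁ (_ , a)           , inj₁ (_ , b))           → asymm o a b
        (inj₁ (inj₁ x≡s , _)    , inj₂ (_ , x≢s , _))     → x≢s x≡s
        (inj₁ (inj₂ y≡s , _)    , inj₂ (y≢s , _ , _))     → y≢s y≡s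
        (inj₂ (x≢s , _ , _)     , inj₁ (inj₂ x≡s , _))    → x≢s x≡s
        (inj₂ (_ , y≢s , _)     , inj₁ (inj₁ y≡s , _))    → y≢s y≡s
        (inj₂ (_ , _ , a)       , inj₂ (_ , _ , b))       → asymm o a b
    }
    where
    reorient : ∀ {x y} → O x y → O₁ x y ⊎ O₁ y x
    reorient {x} {y} xy with x ≟ s | y ≟ s
    ... | yes x≡s | _       = inj₂ (proj₁ (iff _ _) (inj₁ (inj₂ x≡s , xy)))
    ... | no _    | yes y≡s = inj₂ (proj₁ (iff _ _) (inj₁ (inj₁ y≡s , xy)))
    ... | no x≢s  | no y≢s  = inj₁ (proj₁ (iff _ _) (inj₂ (x≢s , y≢s , xy)))

  click⇒potential : ∀ {O O₁} → IsOrientation A O → Click O O₁ → Potential O O₁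
  click⇒potential {O} {O₁} o (s , source , iff) = bump s (const 0) , φ
    where
    φ : IsPotential (bump s (const 0)) O O₁
    φ {x} {y} xy with y ≟ s | x ≟ s
    ... | yes refl | _       = contradiction xy (source x)
    ... | no y≢s   | yes x≡s = inj₂ (refl , proj₁ (iff _ _) (inj₁ (inj₂ x≡s , xy)))
    ... | no y≢s   | no x≢s  = inj₁ (refl , proj₁ (iff _ _) (inj₂ (x≢s , y≢s , xy)))

  clicks⇒potential : ∀ {O O′} → IsOrientation A O → Clicks O O′ → Potential O O′
  clicks⇒potential o (done O≐O′)    = ⊆⇒potential (λ {x} {y} → proj₁ (O≐O′ x y))
  clicks⇒potential o (step cl rest) =
    potential-trans (click⇒potential o cl) (clicks⇒potential (click-orientation o cl) rest)

  module _ {O′ : V → V → Set} (o′ : IsOrientation A O′) where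

    -- Each step clicks the lowest-ranked vertex s with c s > 0; since c does not increase
    -- along arrows, s is a source.
    potential⇒clicks : ∀ k {O} (c r : V → ℕ) → IsOrientation A O → (∀ {x y} → O x y → r x < r y) →
                       IsPotential c O O′ → sum c < k → Clicks O O′
    potential⇒clicks (suc k) {O} c r o O⊆r φ c<k with any? (λ x → 0 <? c x)
    -- Without a positive value no difference can be one, so every arrow is kept.
    ... | no c≡0 = done λ x y →
      (λ xy → [ proj₂ , (λ (eq , _) → contradiction (x , subst (0 <_) (sym eq) (s≤s z≤n)) c≡0) ]′ (φ xy)) ,
      (λ xy′ → [ proj₂ , (λ (eq , _) → contradiction (y , subst (0 <_) (sym eq) (s≤s z≤n)) c≡0) ]′
                 (potential-back o o′ φ xy′))
    ... | yes c>0 with argmin (λ x → 0 <? c x) r c>0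
    ... | s , cs>0 , s-min =
      step click (potential⇒clicks k c₁ (lex (bump s (const 0)) r)
                    (click-orientation o click) O₁⊆r₁ φ₁ (<-≤-trans c₁<c (s≤s⁻¹ c<k)))
      where
      source : ∀ u → ¬ O u s
      source u us = <⇒≱ (O⊆r us) (s-min u (<-≤-trans cs>0 (potential-≤ o o′ φ us)))

      click : Click O (clicked s O)
      click = s , source , λ _ _ → id , id

      -- The rank witnesses acyclicity along the recursion: after the click `s` is a sink and moves
      -- to the top, while the other vertices keep their order.
      O₁⊆r₁ : ∀ {x y} → clicked s O x y → lex (bump s (const 0)) r x < lex (bump s (const 0)) r y
      O₁⊆r₁ (inj₁ (inj₁ refl , yx))   = contradiction yx (source _)
      O₁⊆r₁ {x} (inj₁ (inj₂ refl , yx)) = lex-<₁ (bump s (const 0)) r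
        (subst₂ _<_ (sym (bump-off _ (λ { refl → source s yx }))) (sym (bump-at s _)) (s≤s z≤n))
      O₁⊆r₁ (inj₂ (x≢s , y≢s , xy)) = lex-<₂ (bump s (const 0)) r
        (trans (bump-off _ x≢s) (sym (bump-off _ y≢s))) (O⊆r xy)

      c₁ : V → ℕ
      c₁ x = c x ∸ indicator (x ≟ s)

      c₁-at : suc (c₁ s) ≡ c s
      c₁-at = trans (cong (λ i → suc (c s ∸ i)) (indicator-yes (s ≟ s) refl)) (sym (+-∸-assoc 1 cs>0))

      c₁-off : ∀ {x} → x ≢ s → c₁ x ≡ c x
      c₁-off {x} x≢s = cong (c x ∸_) (indicator-no (x ≟ s) x≢s)

      c₁<c : sum c₁ < sum c
      c₁<c = sum-mono-< {c₁} {c} (λ x → m∸n≤m (c x) (indicator (x ≟ s))) s (≤-reflexive c₁-at)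

      φ₁ : IsPotential c₁ (clicked s O) O′
      φ₁ (inj₁ (inj₁ refl , yx))   = contradiction yx (source _)
      φ₁ (inj₁ (inj₂ refl , yx)) with φ yx
      ... | inj₁ (eq , yx′) = inj₂ (trans (c₁-off (λ { refl → source s yx })) (trans (sym eq) (sym c₁-at)) , yx′)
      ... | inj₂ (eq , xy′) = inj₁ (trans (c₁-off (λ { refl → source s yx }))
                                     (suc-injective (trans (sym eq) (sym c₁-at))) , xy′)
      φ₁ (inj₂ (x≢s , y≢s , xy)) with φ xy
      ... | inj₁ (eq , xy′) = inj₁ (trans (c₁-off x≢s) (trans eq (sym (c₁-off y≢s))) , xy′)
      ... | inj₂ (eq , yx′) = inj₂ (trans (c₁-off x≢s) (trans eq (cong suc (sym (c₁-off y≢s)))) , yx′)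

  rel? : (O : AcycOri A) → ∀ x y → Dec (rel O x y)
  rel? O x y with A? x y
  ... | no ¬xy = no (¬xy ∘ sub O)
  ... | yes xy with total O xy
  ...   | inj₁ x→y = yes x→y
  ...   | inj₂ y→x = no (asym O y→x)

  abstract
    -- The first coordinate counts ancestors; the second only breaks ties.
    ranking : (O : AcycOri A) → ∃[ p ] (Injective _≡_ _≡_ p × (∀ {x y} → rel O x y → p x < p y))
    ranking O = lex ancestors code , lex-injective ancestors code code-injective ,
                λ xy → lex-<₁ ancestors code (ancestors-mono xy)
      where
      _⇝?_ : ∀ x y → Dec (Star (rel O) x y)
      _⇝?_ = Star? (rel? O)

      ancestors : V → ℕ
      ancestors x = sum (λ z → indicator (z ⇝? x))

      close : ∀ {x y z} → Star (rel O) x y → rel O y z → TransClosure (rel O) x z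
      close ε          yz = [ yz ]
      close (xu ◅ uy) yz = xu ∷ close uy yz

      -- Every ancestor of `x` is one of `y`; `y` counts itself but is no ancestor of `x`, as that
      -- would close a cycle.
      ancestors-mono : ∀ {x y} → rel O x y → ancestors x < ancestors y
      ancestors-mono {x} {y} xy = sum-mono-<
        (λ z → indicator-mono (z ⇝? x) (z ⇝? y) (_◅◅ (xy ◅ ε))) y
        (subst₂ _<_ (sym (indicator-no (y ⇝? x) (λ yx → acyclic O y (close yx xy))))
                    (sym (indicator-yes (y ⇝? y) ε)) (s≤s z≤n))

  abstract
    κ⇒potential : ∀ {O O′} → IsOrientation A O → IsOrientation A O′ → O ~κ O′ → Potential O O′
    κ⇒potential o o′ (inj₁ cl) = clicks⇒potential o cl
    κ⇒potential o o′ (inj₂ cl) = potential-sym o′ o finite (clicks⇒potential o′ cl)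

    potential⇒κ : (O O′ : AcycOri A) → Potential (rel O) (rel O′) → rel O ~κ rel O′
    potential⇒κ O O′ (c , φ) = let r , _ , O⊆r = ranking O in
      inj₁ (potential⇒clicks (rel-orientation O′) _ c r (rel-orientation O) O⊆r φ ≤-refl)

  potential : (O O′ : AcycOri A) → rel O ~κ rel O′ → Potential (rel O) (rel O′)
  potential O O′ = κ⇒potential (rel-orientation O) (rel-orientation O′)

  reverse : (O O′ : AcycOri A) → Potential (rel O) (rel O′) → Potential (rel O′) (rel O)
  reverse O O′ = potential-sym (rel-orientation O) (rel-orientation O′) finite

  κ-trans : (O O′ O″ : AcycOri A) → rel O ~κ rel O′ → rel O′ ~κ rel O″ → rel O ~κ rel O″
  κ-trans O O′ O″ e f = potential⇒κ O O″ (potential-trans (potential O O′ e) (potential O′ O″ f))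

  -- Rank functions under clicking, and orientations with a single source.

  Valid : (c p : V → ℕ) → Set
  Valid c p = ∀ {x y} → A x y → p x < p y → c x ≡ c y ⊎ c x ≡ suc (c y)

  -- A vertex clicked more often than its neighbour ends up behind it, and equal counts keep the old
  -- order, so the orientation reached is again given by a rank.
  lex-potential : ∀ {c p} → Valid c p → IsPotential c (induced A p) (induced A (lex c p))
  lex-potential {c} {p} valid (xy , lt) with valid xy lt
  ... | inj₁ eq = inj₁ (eq , xy , lex-<₂ c p eq lt)
  ... | inj₂ eq = inj₂ (eq , A-sym xy , lex-<₁ c p (≤-reflexive (sym eq)))

  abstract
    -- Clicking every vertex that precedes v makes v the first vertex.
    rotate : (v : V) {p : V → ℕ} → Injective _≡_ _≡_ p →
      ∃[ q ] (Injective _≡_ _≡_ q × (∀ x → q v ≤ q x) × Potential (induced A p) (induced A q))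
    rotate v {p} p-inj = lex c p , lex-injective c p p-inj , first , c , lex-potential valid
      where
      c : V → ℕ
      c x = indicator (p x <? p v)

      cv≡0 : c v ≡ 0
      cv≡0 = indicator-no (p v <? p v) (<-irrefl refl)

      first : ∀ x → lex c p v ≤ lex c p x
      first x with <-≤-connex (p x) (p v)
      ... | inj₁ lt = <⇒≤ (lex-<₁ c p (subst₂ _<_ (sym cv≡0) (sym (indicator-yes (p x <? p v) lt)) (s≤s z≤n)))
      ... | inj₂ ge = ≤-trans (≤-reflexive (cong (λ k → k * suc (sum p) + p v) cv≡0)) (≤-trans ge (m≤n+m _ _))

      valid : Valid c p
      valid {x} {y} _ lt with p x <? p v | p y <? p v
      ... | yes _   | yes _   = inj₁ refl
      ... | yes _   | no _    = inj₂ refl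
      ... | no x≮v  | yes y<v = contradiction (<-trans lt y<v) x≮v
      ... | no _    | no _    = inj₁ refl

  -- In terms of ranks, `v` is the only source: the first clause makes it a source, the second
  -- excludes all others.
  Rooted : V → (V → ℕ) → Set
  Rooted v s = (∀ x → s v ≤ s x) × (∀ x → x ≢ v → ∃[ u ] induced A s u x)

  -- Stepping back to in-neighbours lowers the rank, so the walk ends at `v`, and `P` is passed
  -- forward along it.
  root-induction : ∀ {v s} → Rooted v s → (P : V → Set) → P v →
                   (∀ {u x} → induced A s u x → P u → P x) → ∀ x → P x
  root-induction {v} {s} (_ , parent) P Pv next x = <-rec Q descend (s x) x refl
    where
    Q : ℕ → Set
    Q k = ∀ x → s x ≡ k → P x
    descend : ∀ k → (∀ {j} → j < k → Q j) → Q k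
    descend _ rec x refl with x ≟ v
    ... | yes refl = Pv
    ... | no x≢v with parent x x≢v
    ...   | u , ux = next ux (rec (proj₂ ux) u refl)

  abstract
    -- Sources other than v are clicked as long as there are any; a vertex at distance d from v
    -- is clicked at most d times.
    root : (v : V) → (∀ x → Star A v x) → {p : V → ℕ} → Injective _≡_ _≡_ p →
      ∃[ s ] (Injective _≡_ _≡_ s × Rooted v s × Potential (induced A p) (induced A s))
    root v path p-inj with rotate v p-inj
    -- With `v` lowest under `q` and its count fixed at 0, `v` stays lowest under `lex c q` whatever
    -- the other counts become.
    ... | q , q-inj , q-first , p⇒q
      with saturate (λ x → length (path x)) Pinned Done bound next (const 0) (refl , λ _ _ → inj₁ refl)
      where
      length : ∀ {x y} → Star A x y → ℕ
      length ε        = 0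
      length (_ ◅ xs) = suc (length xs)

      Pinned Done : (V → ℕ) → Set
      Pinned c = c v ≡ 0 × Valid c q
      Done c = ∀ x → x ≢ v → ∃[ u ] induced A (lex c q) u x

      lipschitz : ∀ {c} → Valid c q → ∀ {x y} → A x y → c y ≤ suc (c x)
      lipschitz {c} valid {x} {y} xy with <-cmp (q x) (q y)
      ... | tri< lt _ _ = [ (λ eq → ≤-trans (≤-reflexive (sym eq)) (n≤1+n _))
                          , (λ eq → ≤-trans (n≤1+n _) (≤-trans (≤-reflexive (sym eq)) (n≤1+n _))) ]′ (valid xy lt)
      ... | tri≈ _ eq _ = ≤-trans (≤-reflexive (cong c (sym (q-inj eq)))) (n≤1+n _)
      ... | tri> _ _ gt = [ (λ eq → ≤-trans (≤-reflexive eq) (n≤1+n _)) , ≤-reflexive ]′ (valid (A-sym xy) gt)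

      walk-bound : ∀ {c} → Valid c q → ∀ {x y} (xs : Star A x y) → c y ≤ c x + length xs
      walk-bound valid ε = m≤m+n _ 0
      walk-bound {c} valid {x} (xz ◅ xs) = ≤-trans (walk-bound {c} valid xs)
        (≤-trans (+-monoˡ-≤ (length xs) (lipschitz {c} valid xz)) (≤-reflexive (sym (+-suc (c x) _))))

      bound : ∀ {c} → Pinned c → ∀ x → c x ≤ length (path x)
      bound {c} (cv≡0 , valid) x = subst (λ k → c x ≤ k + length (path x)) cv≡0 (walk-bound {c} valid (path x))

      next : ∀ c → Pinned c → Done c ⊎ ∃[ s ] Pinned (bump s c)
      next c (cv≡0 , valid) with any? (λ s → ¬? (s ≟ v) ×-dec ¬? (parent? s))
        where
        parent? : ∀ s → Dec (∃[ u ] induced A (lex c q) u s)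
        parent? s = any? (λ u → A? u s ×-dec (lex c q u <? lex c q s))
      ... | no ∄s = inj₁ λ x x≢v → decidable-stable
        (any? (λ u → A? u x ×-dec (lex c q u <? lex c q x))) (λ ∄u → ∄s (x , x≢v , ∄u))
      ... | yes (s , s≢v , ∄u) = inj₂ (s , trans (bump-off c (s≢v ∘ sym)) cv≡0 , valid′)
        where
        valid′ : Valid (bump s c) q
        valid′ {x} {y} xy lt with x ≟ s | y ≟ s | valid xy lt
        ... | yes refl | yes refl | _       = contradiction xy A-irrefl
        ... | yes refl | no _     | inj₁ eq = inj₂ (cong suc eq)
        -- One more click at `s` would make the difference 2 here, and minus 1 in the case below; in
        -- both, the neighbour lies under `s` in `lex c q`, so `s` would not be a source.
        ... | yes refl | no _     | inj₂ eq = contradiction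
          (y , A-sym xy , lex-<₁ c q (≤-reflexive (sym eq))) ∄u
        ... | no _     | yes refl | inj₁ eq = contradiction (x , xy , lex-<₂ c q eq lt) ∄u
        ... | no _     | yes refl | inj₂ eq = inj₁ eq
        ... | no _     | no _     | inj₁ eq = inj₁ eq
        ... | no _     | no _     | inj₂ eq = inj₂ eq
    ... | c , (cv≡0 , valid) , parent = lex c q , lex-injective c q q-inj ,
      ( (λ x → ≤-trans (≤-reflexive (cong (λ k → k * suc (sum q) + q v) cv≡0)) (≤-trans (q-first x) (m≤n+m _ _)))
      , parent ) ,
      potential-trans p⇒q (c , lex-potential valid)

-- Deletion and contraction of the cycle-edge.

module CycleEdgeRecursion {n : ℕ} (Y : SimpleGraph n) (v w : Fin n)
  (connected : Connected (SimpleGraph.adj Y)) (cycleEdge : CycleEdge (SimpleGraph.adj Y) v w) where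

  A D : Adjacency (Fin n)
  A = SimpleGraph.adj Y
  D = delete A v w

  C : Adjacency (ContrV w)
  C = contract A v w

  vw : A v w
  vw = proj₁ cycleEdge

  v≢w : v ≢ w
  v≢w v≡w = SimpleGraph.irrefl Y (subst (λ x → A x w) v≡w vw)

  A-sym : ∀ {x y} → A x y → A y x
  A-sym = SimpleGraph.sym Y

  A? : ∀ x y → Dec (A x y)
  A? x y with SimpleGraph.dec Y x y
  ... | inj₁ xy  = yes xy
  ... | inj₂ ¬xy = no ¬xy

  D-sym : ∀ {x y} → D x y → D y x
  D-sym (xy , ¬e) = A-sym xy , λ where
    (inj₁ (y≡v , x≡w)) → ¬e (inj₂ (x≡w , y≡v))
    (inj₂ (y≡w , x≡v)) → ¬e (inj₁ (x≡v , y≡w))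

  SameEdge? : ∀ x y → Dec (SameEdge x y v w)
  SameEdge? x y = ((x Fin.≟ v) ×-dec (y Fin.≟ w)) ⊎-dec ((x Fin.≟ w) ×-dec (y Fin.≟ v))

  D? : ∀ x y → Dec (D x y)
  D? x y = A? x y ×-dec ¬? (SameEdge? x y)

  C-sym : ∀ {a b} → C a b → C b a
  C-sym (a≢b , x , y , xy , xa , yb) = a≢b ∘ sym , y , x , A-sym xy , yb , xa

  C? : ∀ a b → Dec (C a b)
  C? (a , _) (b , _) = ¬? (a Fin.≟ b) ×-dec
    Fin.any? (λ x → Fin.any? (λ y → A? x y ×-dec (Merge? x a ×-dec Merge? y b)))
    where
    Merge? : ∀ x a → Dec (Merge v w x a)
    Merge? x a = ((x Fin.≟ w) ×-dec (a Fin.≟ v)) ⊎-dec (¬? (x Fin.≟ w) ×-dec (a Fin.≟ x))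

  merge : Fin n → ContrV w
  merge x with x Fin.≟ w
  ... | yes _  = v , v≢w
  ... | no x≢w = x , x≢w

  merge-Merge : ∀ x → Merge v w x (proj₁ (merge x))
  merge-Merge x with x Fin.≟ w
  ... | yes x≡w = inj₁ (x≡w , refl)
  ... | no x≢w  = inj₂ (x≢w , refl)

  -- Two proofs of x ≢ w are definitionally equal, because ⊥ is a proof-irrelevant record.
  merge-proj₁ : ∀ a → merge (proj₁ a) ≡ a
  merge-proj₁ (x , x≢w) with x Fin.≟ w
  ... | yes x≡w = contradiction x≡w x≢w
  ... | no _    = refl

  -- The merged vertex is listed twice, at `v` and at `w`, which `Finite` allows: it only asks that
  -- `index` be a section of `lookup`.
  contrFinite : Finite (ContrV w)
  contrFinite = record { size = n ; lookup = merge ; index = proj₁ ; lookup-index = merge-proj₁ }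

  module F  = FiniteSet (finFinite n)
  module YO = Orientations (finFinite n) A A-sym (SimpleGraph.irrefl Y) A?
  module DO = Orientations (finFinite n) D D-sym (SimpleGraph.irrefl Y ∘ proj₁) D?
  module CO = Orientations contrFinite C (λ {a} {b} → C-sym {a} {b}) (λ (a≢a , _) → a≢a refl) C?

  OriY : Permutation′ n → AcycOri A
  OriY π = YO.rankedOri (pos-injective π)

  OriD : Permutation′ n → AcycOri D
  OriD π = DO.rankedOri (pos-injective π)

  pos″-injective : (π : Permutation′ n) → Injective _≡_ _≡_ (λ (a : ContrV w) → pos π (proj₁ a))
  pos″-injective π {a} {b} eq =
    trans (sym (merge-proj₁ a)) (trans (cong merge (pos-injective π eq)) (merge-proj₁ b))

  OriC : Permutation′ n → AcycOri C
  OriC π = CO.rankedOri (pos″-injective π)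

  v-first⇒v→w : ∀ π → pos π v ≡ 0 → Oπ A π v w
  v-first⇒v→w π v≡0 = vw , ≤∧≢⇒< (≤-trans (≤-reflexive v≡0) z≤n) (v≢w ∘ pos-injective π)

  rooted⇒v→w : ∀ {s} → Injective _≡_ _≡_ s → YO.Rooted v s → induced A s v w
  rooted⇒v→w s-inj (first , _) = vw , ≤∧≢⇒< (first w) (v≢w ∘ s-inj)

  -- Ancestors of w come first, so that w is as early as the orientation permits.
  sort-rooted : ∀ {s} → Injective _≡_ _≡_ s → YO.Rooted v s →
    ∃[ π ] (pos π v ≡ 0 × (∀ {x y} → A x y → s x < s y → pos π x < pos π y)
            × (∀ x → pos π x < pos π w → Star (induced A s) x w))
  sort-rooted {s} s-inj rooted = π , pos≡0 π v-first , edge , ancestor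
    where
    _⇝w? : ∀ x → Dec (Star (induced A s) x w)
    x ⇝w? = F.Star? (λ x y → A? x y ×-dec (s x <? s y)) x w

    c : Fin n → ℕ
    c x = indicator (¬? (x ⇝w?))

    sorted = sorting (F.lex c s) (F.lex-injective c s s-inj)
    π = proj₁ sorted

    edge : ∀ {x y} → A x y → s x < s y → pos π x < pos π y
    edge {x} {y} xy lt = proj₂ sorted (F.lex-< c s
      (indicator-mono (¬? (x ⇝w?)) (¬? (y ⇝w?)) (λ x↛w y⇝w → x↛w ((xy , lt) ◅ y⇝w))) lt)

    v⇝w : Star (induced A s) v w
    v⇝w = rooted⇒v→w s-inj rooted ◅ ε

    v-first : ∀ x → ¬ pos π x < pos π v
    v-first x x<v with x Fin.≟ v
    ... | yes refl = <-irrefl refl x<v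
    ... | no x≢v   = <-asym x<v (proj₂ sorted (F.lex-< c s
      (indicator-mono (¬? (v ⇝w?)) (¬? (x ⇝w?)) (λ v↛w → contradiction v⇝w v↛w))
      (≤∧≢⇒< (proj₁ rooted x) (x≢v ∘ sym ∘ s-inj))))

    ancestor : ∀ x → pos π x < pos π w → Star (induced A s) x w
    ancestor x x<w = decidable-stable (x ⇝w?) λ x↛w → <-asym x<w (proj₂ sorted (F.lex-<₁ c s
      (subst₂ _<_ (sym (indicator-no (¬? (w ⇝w?)) (λ w↛w → w↛w ε)))
                  (sym (indicator-yes (¬? (x ⇝w?)) x↛w)) (s≤s z≤n))))

  -- The value of `Θ`, read off an orientation with only source `v`.

  module _ {s : Fin n → ℕ} (s-inj : Injective _≡_ _≡_ s) (rooted : YO.Rooted v s) where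

    O-root : AcycOri A
    O-root = YO.rankedOri s-inj

    module _ (O : AcycOri A) (O⇒s : Potential (rel O) (induced A s)) where

      -- Both orientations have the arrow from `v` to `w`, so `c` agrees at its ends; and `c` never
      -- drops along arrows of the rooted one. Ancestors of `w` are thus squeezed between the equal
      -- values `c v` and `c w`.
      module Comparison (σ : Permutation′ n) (v≡0 : pos σ v ≡ 0) (σ~O : Oπ A σ ~κ rel O) where

        σ⇒s : Potential (Oπ A σ) (induced A s)
        σ⇒s = potential-trans (YO.potential (OriY σ) O σ~O) O⇒s

        c = proj₁ σ⇒s
        σ-ori = YO.rel-orientation (OriY σ)
        s-ori = YO.rel-orientation O-root

        cv≡cw : c v ≡ c w
        cv≡cw = potential-≡ σ-ori s-ori (proj₂ σ⇒s) (v-first⇒v→w σ v≡0) (rooted⇒v→w s-inj rooted)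

        cv≤ : ∀ x → c v ≤ c x
        cv≤ = YO.root-induction rooted (λ x → c v ≤ c x) ≤-refl
                (λ ux cv≤cu → ≤-trans cv≤cu (potential-≤′ σ-ori s-ori (proj₂ σ⇒s) ux))

        ≤cw : ∀ {x} → Star (induced A s) x w → c x ≤ c w
        ≤cw ε          = ≤-refl
        ≤cw (xy ◅ y⇝w) = ≤-trans (potential-≤′ σ-ori s-ori (proj₂ σ⇒s) xy) (≤cw y⇝w)

        -- On the ancestors of w the potential is constant, so their arrows are those of Oπ A σ.
        ancestor-≤ : ∀ {x} → Star (induced A s) x w → pos σ x ≤ pos σ w
        ancestor-≤ ε = ≤-refl
        ancestor-≤ {x} (_◅_ {j = y} xy y⇝w) with potential-back σ-ori s-ori (proj₂ σ⇒s) xy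
        ... | inj₁ (_ , _ , lt) = ≤-trans (<⇒≤ lt) (ancestor-≤ y⇝w)
        ... | inj₂ (eq , _) = contradiction
          (≤-trans (≤-reflexive (sym eq)) (≤-trans (≤cw y⇝w) (≤-reflexive (sym cv≡cw))))
          (≤⇒≯ (cv≤ x))

      -- If the arrow from `u` to `w` survives in `τ`, then `u` is at position 0 and equals `v`,
      -- which `D` excludes. If it is reversed, `c u` lies below `c w`, hence below the minimum
      -- `c v`.
      no-vw : ∃[ u ] (D u w × s u < s w) → ¬ HasVW A v w O
      no-vw (u , (uw , ¬e) , su<sw) (τ , v≡0 , w≡1 , τ~O)
        with potential-back (YO.rel-orientation (OriY τ)) (YO.rel-orientation O-root)
               (proj₂ (Comparison.σ⇒s τ v≡0 τ~O)) (uw , su<sw)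
      ... | inj₁ (_ , _ , u<w) = ¬e (inj₁ (pos-injective τ (trans u≡0 (sym v≡0)) , refl))
        where
        u≡0 : pos τ u ≡ 0
        u≡0 = n<1⇒n≡0 (subst (pos τ u <_) w≡1 u<w)
      ... | inj₂ (eq , _) = contradiction (≤-reflexive (trans (sym eq) (sym (Comparison.cv≡cw τ v≡0 τ~O))))
                              (≤⇒≯ (Comparison.cv≤ τ v≡0 τ~O u))

      -- All vertices before `w` in `π` are ancestors of `w` and so precede it in `σ` too; sending
      -- positions to positions gives an injection.
      earliest : (π : Permutation′ n) → (∀ x → pos π x < pos π w → Star (induced A s) x w) →
        ∀ σ → pos σ v ≡ 0 → Oπ A σ ~κ rel O → pos π w ≤ pos σ w
      earliest π ancestor σ v≡0 σ~O = Fin.injective⇒≤ {f = f} f-injective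
        where
        vertex : (i : Fin (pos π w)) → ∃[ x ] pos π x ≡ toℕ i
        vertex i = vertexAt π w (Fin.toℕ<n i)

        earlier : (i : Fin (pos π w)) → pos σ (proj₁ (vertex i)) < pos σ w
        earlier i = ≤∧≢⇒< (Comparison.ancestor-≤ σ v≡0 σ~O (ancestor _ x<w))
                          (λ eq → <⇒≢ x<w (cong (pos π) (pos-injective σ eq)))
          where
          x<w : pos π (proj₁ (vertex i)) < pos π w
          x<w = subst (_< pos π w) (sym (proj₂ (vertex i))) (Fin.toℕ<n i)

        f : Fin (pos π w) → Fin (pos σ w)
        f i = fromℕ< (earlier i)

        f-injective : Injective _≡_ _≡_ f
        f-injective {i} {j} eq = Fin.toℕ-injective
          (trans (sym (proj₂ (vertex i))) (trans (cong (pos π)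
            (pos-injective σ (Fin.fromℕ<-injective _ _ (earlier i) (earlier j) eq))) (proj₂ (vertex j))))

    -- `P` may be any representative of the class, since surjectivity starts from a prescribed one.
    Θ-deletion : (O : AcycOri A) → Potential (rel O) (induced A s) →
      ∃[ u ] (D u w × s u < s w) → (P : AcycOri D) → Potential (induced D s) (rel P) →
      Θ A v w O (inj₁ P)
    Θ-deletion O O⇒s other P s⇒P with sort-rooted s-inj rooted
    ... | π , v≡0 , edge , ancestor =
      no-vw O O⇒s other , π , v≡0 ,
      κ-sym (YO.potential⇒κ O (OriY π) (potential-trans O⇒s (⊆⇒potential λ (xy , lt) → xy , edge xy lt))) ,
      earliest O O⇒s π ancestor ,
      κ-sym (DO.potential⇒κ P (OriD π) (potential-trans (DO.reverse (DO.rankedOri s-inj) P s⇒P)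
        (⊆⇒potential λ (xy , lt) → xy , edge (proj₁ xy) lt)))

    -- When `v` is the only in-neighbour of `w`, the ancestors of `w` are just `v` and `w`, so
    -- listing ancestors first gives an order beginning with `v`, `w`.
    Θ-contraction : (O : AcycOri A) → Potential (rel O) (induced A s) →
      ¬ (∃[ u ] (D u w × s u < s w)) → Σ (AcycOri C) (λ P → Θ A v w O (inj₂ P))
    Θ-contraction O O⇒s alone with sort-rooted s-inj rooted
    ... | π , v≡0 , edge , ancestor = OriC π , π , v≡0 , pos≡1 π v≢w v≡0 v-only ,
      κ-sym (YO.potential⇒κ O (OriY π) (potential-trans O⇒s (⊆⇒potential λ (xy , lt) → xy , edge xy lt))) ,
      κ-refl
      where
      v-or-w : ∀ {x} → Star (induced A s) x w → x ≡ v ⊎ x ≡ w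
      v-or-w ε = inj₂ refl
      v-or-w {x} ((xy , lt) ◅ y⇝w) with v-or-w y⇝w
      ... | inj₁ refl = contradiction lt (≤⇒≯ (proj₁ rooted x))
      ... | inj₂ refl with SameEdge? x w
      ...   | yes (inj₁ (x≡v , _)) = inj₁ x≡v
      ...   | yes (inj₂ (x≡w , _)) = inj₂ x≡w
      ...   | no ¬e = contradiction (x , (xy , ¬e) , lt) alone

      v-only : ∀ x → pos π x < pos π w → x ≡ v
      v-only x x<w with v-or-w (ancestor x x<w)
      ... | inj₁ x≡v  = x≡v
      ... | inj₂ refl = contradiction x<w (<-irrefl refl)

  rootY : (O : AcycOri A) → ∃[ s ] (Injective _≡_ _≡_ s × YO.Rooted v s × Potential (rel O) (induced A s))
  rootY O with YO.ranking O
  ... | p , p-inj , O⊆p with YO.root v (connected v) p-inj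
  ... | s , s-inj , rooted , p⇒s = s , s-inj , rooted ,
    potential-trans (⊆⇒potential λ xy → sub O xy , O⊆p xy) p⇒s

  -- Not being a bridge yields a path only up to double negation, which decidable reachability
  -- removes.
  D-connected : ∀ x → Star D v x
  D-connected x = decidable-stable (F.Star? D? v x) λ v↛x →
    proj₂ cycleEdge (v , x , connected v x , v↛x)

  Θ-total : ∀ O → Σ (Codom A v w) (Θ A v w O)
  Θ-total O with rootY O
  -- Adjacency in `D` excludes `v`, so the test asks for a second in-neighbour of `w`.
  ... | s , s-inj , rooted , O⇒s with Fin.any? (λ u → D? u w ×-dec (s u <? s w))
  ... | yes other = inj₁ P , Θ-deletion s-inj rooted O O⇒s other P (⊆⇒potential id)
    where P = DO.rankedOri s-inj
  ... | no alone with Θ-contraction s-inj rooted O O⇒s alone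
  ...   | P , θ = inj₂ P , θ

  -- Transport of potentials along deletion and contraction.

  potential-delete : ∀ {p q : Fin n → ℕ} → Potential (induced A p) (induced A q) →
                     Potential (induced D p) (induced D q)
  potential-delete (c , φ) = c , λ ((xy , ¬e) , lt) →
    Sum.map (λ (eq , _ , lt′) → eq , (xy , ¬e) , lt′)
            (λ (eq , _ , gt′) → eq , D-sym (xy , ¬e) , gt′) (φ (xy , lt))

  -- Only the deleted edge escapes `φ`. It points the same way on both sides, so it demands equal
  -- values at its ends.
  potential-undelete : ∀ {p q : Fin n → ℕ} → p v < p w → q v < q w →
    ((c , _) : Potential (induced D p) (induced D q)) → c v ≡ c w → Potential (induced A p) (induced A q)
  potential-undelete {p} {q} pv<pw qv<qw (c , φ) cv≡cw = c , ψ
    where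
    ψ : IsPotential c (induced A p) (induced A q)
    ψ {x} {y} (xy , lt) with SameEdge? x y
    ... | yes (inj₁ (refl , refl)) = inj₁ (cv≡cw , vw , qv<qw)
    ... | yes (inj₂ (refl , refl)) = contradiction lt (<-asym pv<pw)
    ... | no ¬e = Sum.map (λ (eq , (xy′ , _) , lt′) → eq , xy′ , lt′)
                          (λ (eq , (yx′ , _) , gt′) → eq , yx′ , gt′) (φ ((xy , ¬e) , lt))

  module _ (π : Permutation′ n) (v≡0 : pos π v ≡ 0) (w≡1 : pos π w ≡ 1) where

    others>1 : ∀ {x} → x ≢ v → x ≢ w → 1 < pos π x
    others>1 {x} x≢v x≢w = ≤∧≢⇒< (n≢0⇒n>0 (λ x≡0 → x≢v (pos-injective π (trans x≡0 (sym v≡0)))))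
                                  (λ 1≡x → x≢w (pos-injective π (trans (sym 1≡x) (sym w≡1))))

    -- No vertex lies between positions 0 and 1, so exchanging `v` and `w` does not affect
    -- comparison with a third vertex; `unmerge-<` rests on the same fact.
    merge-< : ∀ {x y a b} → Merge v w x a → Merge v w y b → a ≢ b → pos π x < pos π y → pos π a < pos π b
    merge-< (inj₁ (refl , refl)) (inj₁ (refl , refl)) a≢b lt = contradiction refl a≢b
    merge-< (inj₁ (refl , refl)) (inj₂ (_ , refl)) a≢b lt = ≤-<-trans (≤-trans (≤-reflexive v≡0) z≤n) lt
    merge-< (inj₂ (x≢w , refl)) (inj₁ (refl , refl)) a≢b lt =
      contradiction (<-trans (others>1 a≢b x≢w) (subst (pos π _ <_) w≡1 lt)) (<-irrefl refl)
    merge-< (inj₂ (_ , refl)) (inj₂ (_ , refl)) a≢b lt = lt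

    unmerge-< : ∀ {x y a b} → Merge v w x a → Merge v w y b → a ≢ b → pos π a < pos π b → pos π x < pos π y
    unmerge-< (inj₁ (refl , refl)) (inj₁ (refl , refl)) a≢b lt = contradiction refl a≢b
    unmerge-< (inj₁ (refl , refl)) (inj₂ (y≢w , refl)) a≢b lt =
      subst (_< _) (sym w≡1) (others>1 (a≢b ∘ sym) y≢w)
    unmerge-< (inj₂ (_ , refl)) (inj₁ (refl , refl)) a≢b lt = contradiction (subst (_ <_) v≡0 lt) n≮0
    unmerge-< (inj₂ (_ , refl)) (inj₂ (_ , refl)) a≢b lt = lt

  module _ (π : Permutation′ n) (πv : pos π v ≡ 0) (πw : pos π w ≡ 1)
           (σ : Permutation′ n) (σv : pos σ v ≡ 0) (σw : pos σ w ≡ 1) where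

    -- `c` takes one value on `v` and `w`, hence descends to the quotient.
    potential-contract : Potential (Oπ A π) (Oπ A σ) → Potential (Oπ'' A v w π) (Oπ'' A v w σ)
    potential-contract (c , φ) = c ∘ proj₁ , λ {a} {b} → ψ {a} {b}
      where
      cv≡cw : c v ≡ c w
      cv≡cw = potential-≡ (YO.rel-orientation (OriY π)) (YO.rel-orientation (OriY σ)) φ
                (v-first⇒v→w π πv) (v-first⇒v→w σ σv)

      c-merge : ∀ {x a} → Merge v w x a → c a ≡ c x
      c-merge (inj₁ (refl , refl)) = cv≡cw
      c-merge (inj₂ (_ , refl))    = refl

      ψ : IsPotential (c ∘ proj₁) (Oπ'' A v w π) (Oπ'' A v w σ)
      ψ {a} {b} (ab@(a≢b , x , y , xy , xa , yb) , lt) with φ (xy , unmerge-< π πv πw xa yb a≢b lt)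
      ... | inj₁ (eq , _ , lt′) = inj₁ (trans (c-merge xa) (trans eq (sym (c-merge yb))) , ab ,
                                        merge-< σ σv σw xa yb a≢b lt′)
      ... | inj₂ (eq , _ , gt′) = inj₂ (trans (c-merge xa) (trans eq (cong suc (sym (c-merge yb)))) ,
                                        C-sym {a} {b} ab , merge-< σ σv σw yb xa (a≢b ∘ sym) gt′)

    -- `c ∘ merge` is constant on `v` and `w`, as the contracted edge requires; every other edge has
    -- distinct images and is governed by `φ`.
    potential-uncontract : Potential (Oπ'' A v w π) (Oπ'' A v w σ) → Potential (Oπ A π) (Oπ A σ)
    potential-uncontract (c , φ) = c ∘ merge , ψ
      where
      same-fibre : ∀ {x y a b} → x ≢ y → Merge v w x a → Merge v w y b → a ≡ b → SameEdge x y v w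
      same-fibre x≢y (inj₁ (refl , refl)) (inj₁ (refl , _)) _ = contradiction refl x≢y
      same-fibre x≢y (inj₁ (refl , refl)) (inj₂ (_ , refl)) refl = inj₂ (refl , refl)
      same-fibre x≢y (inj₂ (_ , refl)) (inj₁ (refl , refl)) refl = inj₁ (refl , refl)
      same-fibre x≢y (inj₂ (_ , refl)) (inj₂ (_ , refl)) refl = contradiction refl x≢y

      merge-v≡merge-w : merge v ≡ merge w
      merge-v≡merge-w with w Fin.≟ w
      ... | yes _  = merge-proj₁ (v , v≢w)
      ... | no w≢w = contradiction refl w≢w

      ψ : IsPotential (c ∘ merge) (Oπ A π) (Oπ A σ)
      ψ {x} {y} (xy , lt) with proj₁ (merge x) Fin.≟ proj₁ (merge y)
      ... | yes a≡b with same-fibre (λ { refl → <-irrefl refl lt }) (merge-Merge x) (merge-Merge y) a≡b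
      ...   | inj₁ (refl , refl) = inj₁ (cong c merge-v≡merge-w , v-first⇒v→w σ σv)
      ...   | inj₂ (refl , refl) = contradiction lt (<-asym (proj₂ (v-first⇒v→w π πv)))
      ψ {x} {y} (xy , lt) | no a≢b
        with φ {merge x} {merge y} ((a≢b , x , y , xy , merge-Merge x , merge-Merge y) ,
                merge-< π πv πw (merge-Merge x) (merge-Merge y) a≢b lt)
      ... | inj₁ (eq , _ , lt′) = inj₁ (eq , xy , unmerge-< σ σv σw (merge-Merge x) (merge-Merge y) a≢b lt′)
      ... | inj₂ (eq , _ , gt′) = inj₂ (eq , A-sym xy ,
                                    unmerge-< σ σv σw (merge-Merge y) (merge-Merge x) (a≢b ∘ sym) gt′)

  -- Well-definedness, injectivity and surjectivity of `Θ`.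

  Θ-wellDefined : ∀ O O′ T T′ → rel O ~κ rel O′ → Θ A v w O T → Θ A v w O′ T′ → T ≈Θ T′
  Θ-wellDefined O O′ (inj₁ P) (inj₁ P′) O~O′ (_ , π , πv , π~O , _ , π~P) (_ , σ , σv , σ~O′ , _ , σ~P′) =
    DO.κ-trans P (OriD π) P′ (κ-sym π~P) (DO.κ-trans (OriD π) (OriD σ) P′
      (DO.potential⇒κ (OriD π) (OriD σ) (potential-delete (YO.potential (OriY π) (OriY σ)
        (YO.κ-trans (OriY π) O (OriY σ) π~O (YO.κ-trans O O′ (OriY σ) O~O′ (κ-sym σ~O′)))))) σ~P′)
  -- Whether some order begins with `v`, `w` depends only on the class, so equivalent orientations
  -- never fall into different branches.
  Θ-wellDefined O O′ (inj₁ P) (inj₂ P′) O~O′ (no-vw , _) (σ , σv , σw , σ~O′ , _) =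
    contradiction (σ , σv , σw , YO.κ-trans (OriY σ) O′ O σ~O′ (κ-sym O~O′)) no-vw
  Θ-wellDefined O O′ (inj₂ P) (inj₁ P′) O~O′ (π , πv , πw , π~O , _) (no-vw , _) =
    contradiction (π , πv , πw , YO.κ-trans (OriY π) O O′ π~O O~O′) no-vw
  Θ-wellDefined O O′ (inj₂ P) (inj₂ P′) O~O′ (π , πv , πw , π~O , π~P) (σ , σv , σw , σ~O′ , σ~P′) =
    CO.κ-trans P (OriC π) P′ (κ-sym π~P) (CO.κ-trans (OriC π) (OriC σ) P′
      (CO.potential⇒κ (OriC π) (OriC σ) (potential-contract π πv πw σ σv σw (YO.potential (OriY π) (OriY σ)
        (YO.κ-trans (OriY π) O (OriY σ) π~O (YO.κ-trans O O′ (OriY σ) O~O′ (κ-sym σ~O′)))))) σ~P′)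

  -- Were `v` the only in-neighbour of `w`, the contraction case would give an order beginning with
  -- `v`, `w`. So `w` keeps an in-neighbour after deletion and no new source arises.
  rootY-delete : (O : AcycOri A) → ¬ HasVW A v w O →
    ∃[ s ] (Injective _≡_ _≡_ s × YO.Rooted v s × DO.Rooted v s × Potential (rel O) (induced A s))
  rootY-delete O no-vw with rootY O
  ... | s , s-inj , rooted@(first , parent) , O⇒s = s , s-inj , rooted , (first , parent′) , O⇒s
    where
    parent′ : ∀ x → x ≢ v → ∃[ u ] induced D s u x
    parent′ x x≢v with x Fin.≟ w
    ... | no x≢w with parent x x≢v
    ...   | u , ux , lt = u , (ux , λ { (inj₁ (_ , x≡w)) → x≢w x≡w ; (inj₂ (_ , x≡v)) → x≢v x≡v }) , lt
    parent′ x x≢v | yes refl with Fin.any? (λ u → D? u w ×-dec (s u <? s w))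
    ... | yes other = other
    ... | no alone with Θ-contraction s-inj rooted O O⇒s alone
    ...   | _ , π , πv , πw , π~O , _ = contradiction (π , πv , πw , π~O) no-vw

  Θ-injective : ∀ O O′ T T′ → Θ A v w O T → Θ A v w O′ T′ → T ≈Θ T′ → rel O ~κ rel O′
  Θ-injective O O′ (inj₂ P) (inj₂ P′) (π , πv , πw , π~O , π~P) (σ , σv , σw , σ~O′ , σ~P′) P~P′ =
    YO.κ-trans O (OriY π) O′ (κ-sym π~O) (YO.κ-trans (OriY π) (OriY σ) O′
      (YO.potential⇒κ (OriY π) (OriY σ) (potential-uncontract π πv πw σ σv σw (CO.potential (OriC π) (OriC σ)
        (CO.κ-trans (OriC π) P (OriC σ) π~P (CO.κ-trans P P′ (OriC σ) P~P′ (κ-sym σ~P′)))))) σ~O′)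
  Θ-injective O O′ (inj₁ P) (inj₁ P′) (no-vw , π , πv , π~O , _ , π~P) (no-vw′ , σ , σv , σ~O′ , _ , σ~P′) P~P′
    with rootY-delete O no-vw | rootY-delete O′ no-vw′
  ... | s , s-inj , rooted , rooted-D , O⇒s | t , t-inj , rooted′ , rooted-D′ , O′⇒t =
    YO.potential⇒κ O O′ (potential-trans O⇒s (potential-trans
      (potential-undelete (proj₂ (rooted⇒v→w s-inj rooted)) (proj₂ (rooted⇒v→w t-inj rooted′)) s⇒t-D cv≡cw)
      (YO.reverse O′ (YO.rankedOri t-inj) O′⇒t)))
    where
    π⇒s : Potential (Oπ A π) (induced A s)
    π⇒s = potential-trans (YO.potential (OriY π) O π~O) O⇒s
    σ⇒t : Potential (Oπ A σ) (induced A t)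
    σ⇒t = potential-trans (YO.potential (OriY σ) O′ σ~O′) O′⇒t

    sD tD : AcycOri D
    sD = DO.rankedOri s-inj
    tD = DO.rankedOri t-inj

    s⇒t-D : Potential (induced D s) (induced D t)
    -- The route in `D` goes from `s` back to `π`, through `P` and `P′` to `σ`, and on to `t`.
    s⇒t-D = potential-trans (DO.reverse (OriD π) sD (potential-delete π⇒s))
      (potential-trans (DO.potential (OriD π) (OriD σ)
        (DO.κ-trans (OriD π) P (OriD σ) π~P (DO.κ-trans P P′ (OriD σ) P~P′ (κ-sym σ~P′))))
        (potential-delete σ⇒t))

    -- v is an ancestor of w in Y′ for both orientations, so c v ≥ c w and c v ≤ c w.
    c = proj₁ s⇒t-D
    cv≡cw : c v ≡ c w
    cv≡cw = ≤-antisym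
      (DO.root-induction rooted-D′ (λ x → c v ≤ c x) ≤-refl (λ ux cv≤cu → ≤-trans cv≤cu
        (potential-≤′ (DO.rel-orientation sD) (DO.rel-orientation tD) (proj₂ s⇒t-D) ux)) w)
      (DO.root-induction rooted-D (λ x → c x ≤ c v) ≤-refl (λ ux cu≤cv → ≤-trans
        (potential-≤ (DO.rel-orientation sD) (DO.rel-orientation tD) (proj₂ s⇒t-D) ux) cu≤cv) w)

  Θ-surjective : ∀ T → Σ (AcycOri A) λ O → Θ A v w O T
  Θ-surjective (inj₁ P) with DO.ranking P
  -- Rooting within `D` gives `w` an in-neighbour there. Restoring the edge as an arrow from `v` to
  -- `w` keeps `v` the only source, and that in-neighbour selects the deletion case.
  ... | p , p-inj , P⊆p with DO.root v D-connected p-inj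
  ... | s , s-inj , (first , parent) , p⇒s =
    O , Θ-deletion s-inj (first , λ x x≢v → let u , (ux , _) , lt = parent x x≢v in u , ux , lt)
          O (⊆⇒potential id) (parent w (v≢w ∘ sym)) P
          (DO.reverse P (DO.rankedOri s-inj) (potential-trans (⊆⇒potential λ xy → sub P xy , P⊆p xy) p⇒s))
    where O = YO.rankedOri s-inj
  Θ-surjective (inj₂ P) with CO.ranking P
  -- The merged vertex is made first, so that splitting it puts `v` and `w` at positions 0 and 1.
  ... | p , p-inj , P⊆p with CO.rotate (v , v≢w) p-inj
  ... | q , q-inj , q-first , p⇒q =
    OriY π , π , πv , pos≡1 π v≢w πv w-second , κ-refl ,
    κ-sym (CO.potential⇒κ P (OriC π) (potential-trans (⊆⇒potential λ {a} {b} ab → sub P ab , P⊆p ab)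
      (potential-trans p⇒q (⊆⇒potential λ {a} {b} (ab , lt) → ab , contracted-edge a b lt))))
    where
    -- Only `v` and `w` share an image under `merge`, so this tie-break just puts `w` behind `v`;
    -- `F.code` makes it injective.
    w-last : Fin n → ℕ
    w-last = F.lex (λ x → indicator (x Fin.≟ w)) F.code

    -- w is inserted directly behind v, with which it shares its image under merge.
    lift : Fin n → ℕ
    lift = F.lex (q ∘ merge) w-last

    sorted = sorting lift (F.lex-injective (q ∘ merge) w-last
               (F.lex-injective (λ x → indicator (x Fin.≟ w)) F.code F.code-injective))
    π = proj₁ sorted

    merge-w : merge w ≡ (v , v≢w)
    merge-w with w Fin.≟ w
    ... | yes _  = refl
    ... | no w≢w = contradiction refl w≢w

    v<w : lift v < lift w
    v<w = F.lex-<₂ (q ∘ merge) w-last (cong q (trans (merge-proj₁ (v , v≢w)) (sym merge-w)))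
      (F.lex-<₁ (λ x → indicator (x Fin.≟ w)) F.code
        (subst₂ _<_ (sym (indicator-no (v Fin.≟ w) v≢w)) (sym (indicator-yes (w Fin.≟ w) refl)) (s≤s z≤n)))

    w<others : ∀ {x} → x ≢ v → x ≢ w → lift w < lift x
    w<others {x} x≢v x≢w = F.lex-<₁ (q ∘ merge) w-last
      (subst (λ k → q k < q (merge x)) (sym merge-w) (≤∧≢⇒< (q-first (merge x))
        (λ eq → x≢v (trans (sym (cong proj₁ (merge-proj₁ (x , x≢w)))) (sym (cong proj₁ (q-inj eq)))))))

    w-second : ∀ x → pos π x < pos π w → x ≡ v
    w-second x x<w with x Fin.≟ v | x Fin.≟ w
    ... | yes x≡v | _        = x≡v
    ... | no _    | yes refl = contradiction x<w (<-irrefl refl)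
    ... | no x≢v  | no x≢w   = contradiction x<w (<-asym (proj₂ sorted (w<others x≢v x≢w)))

    πv : pos π v ≡ 0
    πv = pos≡0 π λ x x<v → <-irrefl (cong (pos π) (w-second x (<-trans x<v (proj₂ sorted v<w)))) x<v

    contracted-edge : ∀ a b → q a < q b → pos π (proj₁ a) < pos π (proj₁ b)
    contracted-edge a b lt = proj₂ sorted (F.lex-<₁ (q ∘ merge) w-last
      (subst₂ (λ a b → q a < q b) (sym (merge-proj₁ a)) (sym (merge-proj₁ b)) lt))

theorem2 : (n : ℕ) (Y : SimpleGraph n) (v w : Fin n) →
    Connected (SimpleGraph.adj Y) →
    CycleEdge (SimpleGraph.adj Y) v w →
    IsBijectionΘ (SimpleGraph.adj Y) v w
theorem2 n Y v w connected cycleEdge = Θ-total , Θ-wellDefined , Θ-injective , Θ-surjective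
  where open CycleEdgeRecursion Y v w connected cycleEdge
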